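{- For every integer $k\ge 2$, $$\sup_{n\ge 1}\mathrm{HGP}(B_{k,n})=C_k .$$ Moreover, there is an integer $N_k<\infty$ such that $\mathrm{HGP}(B_{k,n})=C_k$ for every $n\ge N_k$.
   Context: Proper hat-guessing game: let $G=(V,E)$ be a finite simple graph and $[q]=\{0,1,\dots,q-1\}$. Before play, the vertices agree on deterministic guess functions; the guess of each vertex is a function of the colors on its open neighborhood, with values in $[q]$. An adversary assigns a color from $[q]$ to every vertex so that adjacent vertices get distinct colors (a proper $q$-coloring). All vertices simultaneously guess their own colors. A strategy (family of guess functions) is winning with $q$ colors if for every proper $q$-coloring at least one vertex guesses its own color correctly. The proper hat-guessing number $\mathrm{HGP}(G)$ is the largest $q$ for which a winning strategy exists. The book graph is $B_{k,n}=K_k\vee\overline{K_n}$ (join): $k$ mutually adjacent vertices (spines) and $n$ pairwise nonadjacent vertices (pages), every page adjacent to every spine. A proper $k$-tuple is a $k$-tuple $\boldsymbol{x}=(x_1,\dots,x_k)$ of pairwise distinct colors; a configuration is a set $P$ of proper $k$-tuples, with colors drawn from some finite set. Let $\pi_i(\boldsymbol{x})$ be the $(k-1)$-tuple obtained by deleting coordinate $i$. A set $A$ of proper $k$-tuples is $i$-saturated if $\pi_i$ restricted to $A$ is injective. A configuration $P$ is coverable if it can be partitioned as $P=P_1\,\dot\cup\cdots\dot\cup\,P_k$ (parts may be empty) with $P_i$ being $i$-saturated for every $i$. Let $\mathrm{supp}(P)=\bigcup_{\boldsymbol{x}\in P}\{x_1,\dots,x_k\}$. Define $$C_k=\min\{|P|+|\mathrm{supp}(P)|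 : P \text{ is a finite non-coverable configuration of proper } k\text{ -tuples}\},$$ where the colors may be drawn from any finite set. -}

module Defs where

open import Data.Nat.Base using (ℕ; suc; pred; _+_; _≤_)
open import Data.Fin.Base using (Fin)
open import Data.Fin.Properties using (_≟_; +↔⊎)
open import Data.Fin.Subset using (Subset; ⋃; ⁅_⁆; ∣_∣)
open import Data.Vec.Base using (Vec; removeAt; toList)
import Data.Vec.Relation.Unary.Unique.Propositional as Vec
open import Data.List.Base using (List; length; map; concatMap)
open import Data.List.Membership.Propositional using (_∈_)
open import Data.List.Relation.Binary.Disjoint.Propositional using (Disjoint)
open import Data.List.Relation.Unary.All using (All)
import Data.List.Relation.Unary.Unique.Propositional as List
open import Data.Product.Base using (_×_; Σ-syntax; ∃-syntax)
open import Data.Sum.Base using (_⊎_; inj₁; inj₂)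
open import Data.Sum.Function.Propositional using (_⊎-↔_)
open import Data.Empty using (⊥)
open import Data.Unit.Base using (⊤; tt)
open import Function.Base using (id)
open import Function.Bundles using (_↔_; _⇔_)
open import Function.Construct.Composition using (_↔-∘_)
open import Function.Construct.Identity using (↔-id)
open import Relation.Binary.Definitions using (Decidable; Symmetric)
open import Relation.Binary.PropositionalEquality using (_≡_; _≢_; refl; ≢-sym)
open import Relation.Nullary using (¬_; yes; no; ¬?)

------------------------------------------------------------------------
-- Extremal elements of sets of natural numbers

IsGreatest : (ℕ → Set) → ℕ → Set
IsGreatest S m = S m × (∀ q → S q → q ≤ m)

IsLeast : (ℕ → Set) → ℕ → Set
IsLeast S m = S m × (∀ q → S q → m ≤ q)

IsUpperBound : (ℕ → Set) → ℕ → Set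
IsUpperBound S b = ∀ q → S q → q ≤ b

IsSupremum : (ℕ → Set) → ℕ → Set
IsSupremum S = IsLeast (IsUpperBound S)

------------------------------------------------------------------------
-- Graphs

record FiniteSimpleGraph : Set₁ where
  field
    Vertex : Set
    order  : ℕ
    enum   : Fin order ↔ Vertex
    Adj    : Vertex → Vertex → Set
    adj?   : Decidable Adj
    sym    : Symmetric Adj
    irrefl : ∀ {v} → ¬ Adj v v

complete : ℕ → FiniteSimpleGraph
complete n = record
  { Vertex = Fin n
  ; order  = n
  ; enum   = ↔-id (Fin n)
  ; Adj    = _≢_
  ; adj?   = λ u v → ¬? (u ≟ v)
  ; sym    = ≢-sym
  ; irrefl = λ v≢v → v≢v refl
  }

edgeless : ℕ → FiniteSimpleGraph
edgeless n = record
  { Vertex = Fin n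
  ; order  = n
  ; enum   = ↔-id (Fin n)
  ; Adj    = λ _ _ → ⊥
  ; adj?   = λ _ _ → no id
  ; sym    = id
  ; irrefl = id
  }

module _ (G H : FiniteSimpleGraph) where
  private
    module G = FiniteSimpleGraph G
    module H = FiniteSimpleGraph H

  JoinAdj : G.Vertex ⊎ H.Vertex → G.Vertex ⊎ H.Vertex → Set
  JoinAdj (inj₁ u) (inj₁ v) = G.Adj u v
  JoinAdj (inj₁ _) (inj₂ _) = ⊤
  JoinAdj (inj₂ _) (inj₁ _) = ⊤
  JoinAdj (inj₂ u) (inj₂ v) = H.Adj u v

  private
    joinAdj? : Decidable JoinAdj
    joinAdj? (inj₁ u) (inj₁ v) = G.adj? u v
    joinAdj? (inj₁ _) (inj₂ _) = yes tt
    joinAdj? (inj₂ _) (inj₁ _) = yes tt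
    joinAdj? (inj₂ u) (inj₂ v) = H.adj? u v

    joinSym : Symmetric JoinAdj
    joinSym {inj₁ _} {inj₁ _} = G.sym
    joinSym {inj₁ _} {inj₂ _} = id
    joinSym {inj₂ _} {inj₁ _} = id
    joinSym {inj₂ _} {inj₂ _} = H.sym

    joinIrrefl : ∀ {v} → ¬ JoinAdj v v
    joinIrrefl {inj₁ _} = G.irrefl
    joinIrrefl {inj₂ _} = H.irrefl

  join : FiniteSimpleGraph
  join = record
    { Vertex = G.Vertex ⊎ H.Vertex
    ; order  = G.order + H.order
    ; enum   = (G.enum ⊎-↔ H.enum) ↔-∘ +↔⊎
    ; Adj    = JoinAdj
    ; adj?   = joinAdj?
    ; sym    = λ {u} {v} → joinSym {u} {v}
    ; irrefl = λ {v} → joinIrrefl {v}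
    }

Book : ℕ → ℕ → FiniteSimpleGraph
Book k n = join (complete k) (edgeless n)

------------------------------------------------------------------------
-- The proper hat-guessing game

module _ (G : FiniteSimpleGraph) (q : ℕ) where
  open FiniteSimpleGraph G

  Coloring : Set
  Coloring = Vertex → Fin q

  Proper : Coloring → Set
  Proper c = ∀ u v → Adj u v → c u ≢ c v

  -- Adjacency is an irrelevant argument, so that what v sees is exactly one
  -- color per neighbor, whatever the proof of adjacency.
  View : Vertex → Set
  View v = ∀ u → .(Adj v u) → Fin q

  -- Function extensionality is unavailable, so guesses are required
  -- to depend only on the visible colors.
  record Guess (v : Vertex) : Set where
    field
      guess : View v → Fin q
      cong  : ∀ {f g : View v} → (∀ u .(a : Adj v u) → f u a ≡ g u a) →
              guess f ≡ guess g

  Strategy : Set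
  Strategy = ∀ v → Guess v

  Winning : Strategy → Set
  Winning s = ∀ (c : Coloring) → Proper c →
              ∃[ v ] Guess.guess (s v) (λ u _ → c u) ≡ c v

  HasWinningStrategy : Set
  HasWinningStrategy = Σ[ s ∈ Strategy ] Winning s

-- The proper hat-guessing number of G exists and equals h.
IsHGP : FiniteSimpleGraph → ℕ → Set
IsHGP G = IsGreatest (HasWinningStrategy G)

------------------------------------------------------------------------
-- Configurations of proper tuples with colors in Fin m

-- A finite set of proper k-tuples, listed without repetition.
record Configuration (k m : ℕ) : Set where
  field
    tuples : List (Vec (Fin m) k)
    proper : All Vec.Unique tuples
    unique : List.Unique tuples

open Configuration public using (tuples)

size : ∀ {k m} → Configuration k m → ℕ
size P = length (tuples P)

supp : ∀ {k m} → Configuration k m → Subset m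
supp P = ⋃ (concatMap (λ x → map ⁅_⁆ (toList x)) (tuples P))

-- The length is written pred k so that k itself need not be a successor;
-- the index i already forces k to be positive.
π : ∀ {A : Set} {k} → Fin k → Vec A k → Vec A (pred k)
π {k = suc _} i x = removeAt x i

Saturated : ∀ {k m} → Fin k → List (Vec (Fin m) k) → Set
Saturated i A = ∀ {x y} → x ∈ A → y ∈ A → π i x ≡ π i y → x ≡ y

-- The parts are sets given by lists; repetitions in them are immaterial.
record Coverable {k m : ℕ} (P : Configuration k m) : Set where
  field
    part      : Fin k → List (Vec (Fin m) k)
    union     : ∀ x → x ∈ tuples P ⇔ (∃[ i ] x ∈ part i)
    disjoint  : ∀ {i j} → i ≢ j → Disjoint (part i) (part j)
    saturated : ∀ i → Saturated i (part i)

-- The minimum defining C_k exists and equals c.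
IsC : ℕ → ℕ → Set
IsC k = IsLeast λ s →
  ∃[ m ] Σ[ P ∈ Configuration k m ] (¬ Coverable P × s ≡ size P + ∣ supp P ∣)

{-# OPTIONS --safe #-}
module Submission where

-- Upper bound: let P be non-coverable and q > |P| + |supp P|. Once the spines
-- are restricted to P, every page has a color outside supp P that differs from
-- all |P| of its possible guesses. With the pages so colored, the tuples of P on
-- which spine i is right form an i-saturated set, so some tuple defeats everyone.
--
-- Lower bound: take one page for each function from tuples to colors. For any
-- page coloring, the tuples R compatible with it and on which all pages are wrong
-- satisfy |R| + |supp R| < q, as otherwise some page's guesses on R exhaust the
-- colors outside supp R. If all such R are coverable, spine i guesses according to
-- the part R_i.
--
-- Hence C is found as the last q ≥ 1 for which every configuration in q colors
-- with |P| + |supp P| < q is coverable.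

open import Defs
open import Data.Nat.Base using (ℕ; zero; suc; _+_; _*_; _∸_; _^_; _≤_; _<_; z≤n; s≤s)
import Data.Nat.Properties as ℕ
open import Data.Fin.Base
  using (Fin; zero; suc; toℕ; fromℕ<; inject≤; combine; funToFin; finToFun; punchIn;
    punchOut)
open import Data.Fin.Properties
  using (_≟_; any?; all?; injective⇒≤; inject≤-injective; suc-injective;
    combine-injective; finToFun-funToFin; funToFin-finToFin; toℕ-inject≤; toℕ<n;
    toℕ-fromℕ<; toℕ-injective; punchIn-punchOut)
open import Data.Fin.Subset
  using (Subset; inside; outside; ⋃; ∁; ∣_∣) renaming (_∈_ to _∈ₛ_)
open import Data.Fin.Subset.Properties
  using (anySubset?; x∈p∪q⁺; x∈p∪q⁻; ∉⊥; x∈⁅x⁆; x∈⁅y⁆⇒x≡y; x∉p⇒x∈∁p; ∣∁p∣≡n∸∣p∣)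
    renaming (_∈?_ to _∈ₛ?_)
open import Data.Vec.Base using (Vec; []; _∷_; here; there; lookup; tabulate; removeAt)
open import Data.Vec.Properties
  using (≡-dec; lookup∘tabulate; tabulate∘lookup; tabulate-cong; removeAt-punchOut;
    lookup⇒[]=; []=⇒lookup)
import Data.Vec.Relation.Unary.Any as VecAny
import Data.Vec.Relation.Unary.Any.Properties as VecAnyₚ
import Data.Vec.Relation.Unary.AllPairs as VecAllPairs
import Data.Vec.Relation.Unary.Unique.Propositional as Vec
import Data.Vec.Relation.Unary.Unique.Propositional.Properties as Vec
import Data.Vec.Membership.Propositional.Properties as Vec
open import Data.List.Base
  using (List; []; _∷_; _++_; length; map; filter; allFin)
    renaming (tabulate to tabulateₗ)
open import Data.List.Properties using (length-map; length-++; length-tabulate)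
open import Data.List.Membership.Propositional using (_∈_; _∉_; find)
open import Data.List.Membership.Propositional.Properties
  using (∈-map⁺; ∈-map⁻; ∈-filter⁺; ∈-filter⁻; ∈-++⁺ˡ; ∈-++⁺ʳ; ∈-allFin; ∈-tabulate⁺;
    ∈-lookup)
import Data.List.Membership.Setoid.Properties as SetoidMembership
import Data.List.Membership.DecPropositional as DecMembership
open import Data.List.Relation.Unary.Any using (Any; here; there; index)
import Data.List.Relation.Unary.Any as Any
import Data.List.Relation.Unary.Any.Properties as Any
open import Data.List.Relation.Unary.All using (All; []; _∷_)
import Data.List.Relation.Unary.All as All
import Data.List.Relation.Unary.All.Properties as All
open import Data.List.Relation.Unary.AllPairs using ([]; _∷_)
import Data.List.Relation.Unary.Unique.Propositional as List
import Data.List.Relation.Unary.Unique.Propositional.Properties as List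
open import Data.Product.Base using (_×_; _,_; proj₁; proj₂; ∃; ∃-syntax)
open import Data.Sum.Base using (_⊎_; inj₁; inj₂)
open import Data.Unit.Base using (tt)
open import Function.Base using (_∘_; const)
open import Function.Bundles using (Inverse; Equivalence; mk⇔)
open import Relation.Binary.Definitions using (DecidableEquality)
open import Relation.Binary.PropositionalEquality
  using (_≡_; _≢_; refl; sym; trans; cong; cong₂; subst; setoid; module ≡-Reasoning)
open import Relation.Nullary using (¬_; Dec; yes; no; ¬?; does; contradiction)
open import Relation.Nullary.Decidable
  using (map′; _×-dec_; _→-dec_; decidable-stable; recompute; dec-true)
open import Relation.Unary using (Decidable)

private
  variable
    A : Set
    k m n q : ℕ

-- Finite search, coded tuples and pigeonhole.

choose : {P : Fin (suc n) → Set} → Decidable P → Fin (suc n)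
choose P? with any? P?
... | yes (i , _) = i
... | no  _       = zero

choose-correct : {P : Fin (suc n) → Set} (P? : Decidable P) → ∃ P → P (choose P?)
choose-correct P? p with any? P?
... | yes (_ , pᵢ) = pᵢ
... | no  ¬p       = contradiction p ¬p

lookup-ext : {x y : Vec A k} → (∀ i → lookup x i ≡ lookup y i) → x ≡ y
lookup-ext {x = x} {y} x≗y =
  trans (sym (tabulate∘lookup x)) (trans (tabulate-cong x≗y) (tabulate∘lookup y))

π⁻ : {x y : Vec A k} {i j : Fin k} → π i x ≡ π i y → i ≢ j → lookup x j ≡ lookup y j
π⁻ {k = suc _} {x} {y} πx≡πy i≢j = begin
  lookup x _                              ≡⟨ removeAt-punchOut x i≢j ⟨
  lookup (removeAt x _) (punchOut i≢j)    ≡⟨ cong (λ z → lookup z (punchOut i≢j)) πx≡πy ⟩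
  lookup (removeAt y _) (punchOut i≢j)    ≡⟨ removeAt-punchOut y i≢j ⟩
  lookup y _                              ∎
  where open ≡-Reasoning

π⁺ : {x y : Vec A k} {i : Fin k} → (∀ j → i ≢ j → lookup x j ≡ lookup y j) → π i x ≡ π i y
π⁺ {x = _ ∷ _} {_ ∷ _} {zero} x≗y = lookup-ext (λ j → x≗y (suc j) λ ())
π⁺ {x = _ ∷ x@(_ ∷ _)} {_ ∷ y@(_ ∷ _)} {suc i} x≗y =
  cong₂ _∷_ (x≗y zero λ ()) (π⁺ {x = x} {y} {i} (λ j i≢j → x≗y (suc j) (i≢j ∘ suc-injective)))

encode : Vec (Fin m) k → Fin (m ^ k)
encode = funToFin ∘ lookup

decode : Fin (m ^ k) → Vec (Fin m) k
decode = tabulate ∘ finToFun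

decode-encode : (x : Vec (Fin m) k) → decode (encode x) ≡ x
decode-encode x = trans (tabulate-cong (finToFun-funToFin (lookup x))) (tabulate∘lookup x)

funToFin-cong : {f g : Fin k → Fin m} → (∀ i → f i ≡ g i) → funToFin f ≡ funToFin g
funToFin-cong {zero}  f≗g = refl
funToFin-cong {suc k} f≗g = cong₂ combine (f≗g zero) (funToFin-cong (f≗g ∘ suc))

finToFun-injective : {a b : Fin (m ^ k)} → (∀ i → finToFun {m} {k} a i ≡ finToFun b i) → a ≡ b
finToFun-injective {m} {k} {a} {b} eq =
  trans (sym (funToFin-finToFin {k} {m} a)) (trans (funToFin-cong eq) (funToFin-finToFin {k} {m} b))

decode-injective : {a b : Fin (m ^ k)} → decode {m} {k} a ≡ decode b → a ≡ b
decode-injective {m} {k} {a} {b} eq = finToFun-injective {m} {k} λ i → begin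
  finToFun a i          ≡⟨ lookup∘tabulate (finToFun {m} {k} a) i ⟨
  lookup (decode a) i   ≡⟨ cong (λ x → lookup x i) eq ⟩
  lookup (decode b) i   ≡⟨ lookup∘tabulate (finToFun {m} {k} b) i ⟩
  finToFun b i          ∎
  where open ≡-Reasoning

anyVec? : {P : Vec (Fin m) k → Set} → Decidable P → Dec (∃ P)
anyVec? {P = P} P? = map′
  (λ (a , p) → decode a , p)
  (λ (x , p) → encode x , subst P (sym (decode-encode x)) p)
  (any? (P? ∘ decode))

allVec? : {P : Vec (Fin m) k → Set} → Decidable P → Dec (∀ x → P x)
allVec? {P = P} P? = map′
  (λ p x → subst P (decode-encode x) (p (encode x)))
  (λ p → p ∘ decode)
  (all? (P? ∘ decode))

_≟ᵥ_ : DecidableEquality (Vec (Fin m) k)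
_≟ᵥ_ = ≡-dec _≟_

_∈ᵥ?_ : (x : Vec (Fin m) k) (xs : List (Vec (Fin m) k)) → Dec (x ∈ xs)
_∈ᵥ?_ = DecMembership._∈?_ _≟ᵥ_

index-injective : {x y : A} {xs : List A} (x∈xs : x ∈ xs) (y∈xs : y ∈ xs) →
                  index x∈xs ≡ index y∈xs → x ≡ y
index-injective {A} = SetoidMembership.index-injective (setoid A)

-- If every color occurred in `xs`, its positions would inject `Fin q` into `Fin (length xs)`.
missing : (xs : List (Fin q)) → length xs < q → ∃[ y ] y ∉ xs
missing {q} xs ∣xs∣<q with any? (λ y → ¬? (DecMembership._∈?_ _≟_ y xs))
... | yes y∉xs = y∉xs
... | no  ¬y∉xs = contradiction
  (injective⇒≤ {f = index ∘ ∈xs} (index-injective (∈xs _) (∈xs _))) (ℕ.<⇒≱ ∣xs∣<q)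
  where
  ∈xs : ∀ y → y ∈ xs
  ∈xs y = decidable-stable (DecMembership._∈?_ _≟_ y xs) (λ y∉xs → ¬y∉xs (y , y∉xs))

assign : {A B : Set} → DecidableEquality A → B → List A → List B → A → B
assign _≟ᴬ_ default (x ∷ xs) (y ∷ ys) z with z ≟ᴬ x
... | yes _ = y
... | no  _ = assign _≟ᴬ_ default xs ys z
assign _≟ᴬ_ default _ _ _ = default

-- The length bound gives each entry of `ys` a partner in `xs`, and uniqueness of `xs` keeps an
-- earlier entry from shadowing it. This yields a guess function exhausting a given list of colors.
assign-onto : {A B : Set} (_≟ᴬ_ : DecidableEquality A) (d : B) {xs : List A} {ys : List B} →
              List.Unique xs → length ys ≤ length xs →
              ∀ {y} → y ∈ ys → ∃[ x ] x ∈ xs × assign _≟ᴬ_ d xs ys x ≡ y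
assign-onto _≟ᴬ_ d {x ∷ xs} {y ∷ ys} (x∉xs ∷ u) (s≤s l) (here refl) = x , here refl , lemma
  where
  lemma : assign _≟ᴬ_ d (x ∷ xs) (y ∷ ys) x ≡ y
  lemma with x ≟ᴬ x
  ... | yes _   = refl
  ... | no  x≢x = contradiction refl x≢x
assign-onto _≟ᴬ_ d {x ∷ xs} {y ∷ ys} (x∉xs ∷ u) (s≤s l) (there y∈ys)
  with z , z∈xs , eq ← assign-onto _≟ᴬ_ d u l y∈ys = z , there z∈xs , lemma
  where
  lemma : assign _≟ᴬ_ d (x ∷ xs) (y ∷ ys) z ≡ _
  lemma with z ≟ᴬ x
  ... | yes refl = contradiction refl (All.lookup x∉xs z∈xs)
  ... | no  _    = eq

-- Subsets of `Fin n` as lists, and supports of configurations.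

elements : Subset n → List (Fin n)
elements []            = []
elements (inside  ∷ S) = zero ∷ map suc (elements S)
elements (outside ∷ S) = map suc (elements S)

length-elements : (S : Subset n) → length (elements S) ≡ ∣ S ∣
length-elements []            = refl
length-elements (inside  ∷ S) = cong suc (trans (length-map suc (elements S)) (length-elements S))
length-elements (outside ∷ S) = trans (length-map suc (elements S)) (length-elements S)

∈-elements⁺ : {S : Subset n} {a : Fin n} → a ∈ₛ S → a ∈ elements S
∈-elements⁺ {S = inside  ∷ S} here        = here refl
∈-elements⁺ {S = inside  ∷ S} (there a∈S) = there (∈-map⁺ suc (∈-elements⁺ a∈S))
∈-elements⁺ {S = outside ∷ S} (there a∈S) = ∈-map⁺ suc (∈-elements⁺ a∈S)

∈-elements⁻ : {S : Subset n} {a : Fin n} → a ∈ elements S → a ∈ₛ S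
∈-elements⁻ {S = inside  ∷ S} (here refl) = here
∈-elements⁻ {S = inside  ∷ S} (there a∈)
  with _ , b∈ , refl ← ∈-map⁻ suc a∈ = there (∈-elements⁻ b∈)
∈-elements⁻ {S = outside ∷ S} a∈
  with _ , b∈ , refl ← ∈-map⁻ suc a∈ = there (∈-elements⁻ b∈)

elements-unique : (S : Subset n) → List.Unique (elements S)
elements-unique []            = []
elements-unique (inside  ∷ S) =
  All.map⁺ (All.tabulate λ _ ()) ∷ List.map⁺ suc-injective (elements-unique S)
elements-unique (outside ∷ S) = List.map⁺ suc-injective (elements-unique S)

comprehension : {P : Fin n → Set} → Decidable P → Subset n
comprehension P? = tabulate (does ∘ P?)

∈-comprehension⁺ : {P : Fin n → Set} (P? : Decidable P) {a : Fin n} → P a → a ∈ₛ comprehension P?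
∈-comprehension⁺ P? {a} p =
  lookup⇒[]= a _ (trans (lookup∘tabulate (does ∘ P?) a) (dec-true (P? a) p))

∈-comprehension⁻ : {P : Fin n → Set} (P? : Decidable P) {a : Fin n} → a ∈ₛ comprehension P? → P a
∈-comprehension⁻ P? {a} a∈ with P? a | trans (sym (lookup∘tabulate (does ∘ P?) a)) ([]=⇒lookup a∈)
... | yes p | _ = p

∈-⋃⁺ : {y : Fin n} (Ss : List (Subset n)) → Any (y ∈ₛ_) Ss → y ∈ₛ ⋃ Ss
∈-⋃⁺ (S ∷ Ss) (here y∈S)   = x∈p∪q⁺ (inj₁ y∈S)
∈-⋃⁺ (S ∷ Ss) (there y∈Ss) = x∈p∪q⁺ (inj₂ (∈-⋃⁺ Ss y∈Ss))

∈-⋃⁻ : {y : Fin n} (Ss : List (Subset n)) → y ∈ₛ ⋃ Ss → Any (y ∈ₛ_) Ss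
∈-⋃⁻ []       y∈ = contradiction y∈ ∉⊥
∈-⋃⁻ (S ∷ Ss) y∈ with x∈p∪q⁻ S (⋃ Ss) y∈
... | inj₁ y∈S  = here y∈S
... | inj₂ y∈Ss = there (∈-⋃⁻ Ss y∈Ss)

∈-supp⁺ : (P : Configuration k m) {x : Vec (Fin m) k} → x ∈ tuples P → ∀ i → lookup x i ∈ₛ supp P
∈-supp⁺ P {x} x∈P i = ∈-⋃⁺ _ (Any.concatMap⁺ _ (Any.map (λ { refl → Any.map⁺ singleton }) x∈P))
  where
  singleton = Any.map (λ { refl → x∈⁅x⁆ _ }) (Vec.∈-toList⁺ (Vec.∈-lookup i x))

∈-supp⁻ : (P : Configuration k m) {y : Fin m} → y ∈ₛ supp P →
          ∃[ x ] x ∈ tuples P × ∃[ i ] lookup x i ≡ y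
∈-supp⁻ P y∈
  with x , x∈P , y∈x ← find (Any.concatMap⁻ _ (∈-⋃⁻ _ y∈))
  with z , z∈x , y∈z ← find (Any.map⁻ y∈x)
  with refl ← x∈⁅y⁆⇒x≡y z y∈z
  = x , x∈P , VecAny.index z∈ᵥx , sym (VecAnyₚ.lookup-index z∈ᵥx)
  where z∈ᵥx = Vec.∈-toList⁻ z∈x

-- Deciding coverability.

total : Configuration k m → ℕ
total P = size P + ∣ supp P ∣

-- An assignment of owners to tuples encodes a partition into k parts.
Valid : Configuration k m → (Vec (Fin m) k → Fin k) → Set
Valid P owner = All (λ x → All (λ y →
  owner x ≡ owner y → π (owner x) x ≡ π (owner x) y → x ≡ y) (tuples P)) (tuples P)

valid? : (P : Configuration k m) → Decidable (Valid P)
valid? P owner = All.all? (λ x → All.all? (λ y →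
  (owner x ≟ owner y) →-dec ((π (owner x) x ≟ᵥ π (owner x) y) →-dec (x ≟ᵥ y)))
  (tuples P)) (tuples P)

valid⇒coverable : (P : Configuration k m) {owner : Vec (Fin m) k → Fin k} →
                  Valid P owner → Coverable P
valid⇒coverable P {owner} valid = record
  { part      = λ i → filter (owned i) (tuples P)
  ; union     = λ x → mk⇔ (λ x∈P → owner x , ∈-filter⁺ (owned (owner x)) x∈P refl)
                          (λ (i , x∈) → proj₁ (∈-filter⁻ (owned i) x∈))
  ; disjoint  = λ {i} {j} i≢j (x∈i , x∈j) →
      i≢j (trans (sym (proj₂ (∈-filter⁻ (owned i) {xs = tuples P} x∈i)))
                 (proj₂ (∈-filter⁻ (owned j) {xs = tuples P} x∈j)))
  ; saturated = λ i {x} {y} x∈i y∈i πx≡πy →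
      let x∈P , x≡i = ∈-filter⁻ (owned i) x∈i
          y∈P , y≡i = ∈-filter⁻ (owned i) y∈i
      in All.lookup (All.lookup valid x∈P) y∈P (trans x≡i (sym y≡i))
           (subst (λ j → π j x ≡ π j y) (sym x≡i) πx≡πy)
  }
  where
  owned : ∀ i → Decidable (λ x → owner x ≡ i)
  owned i x = owner x ≟ i

-- The owner is a part found by search. On tuples of `P` the union clause provides one; elsewhere
-- the default `zero` is never inspected.
coverable⇒valid : {P : Configuration (suc k) m} → Coverable P → ∃ (Valid P)
coverable⇒valid {P = P} cover = owner ,
  All.tabulate (λ {x} x∈P → All.tabulate (λ {y} y∈P ox≡oy →
    saturated (owner x) (own x∈P) (subst (λ i → y ∈ part i) (sym ox≡oy) (own y∈P))))
  where
  open Coverable cover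
  owner = λ x → choose (λ i → x ∈ᵥ? part i)
  own : ∀ {x} → x ∈ tuples P → x ∈ part (owner x)
  own {x} x∈P = choose-correct (λ i → x ∈ᵥ? part i) (Equivalence.to (union x) x∈P)

valid-cong : (P : Configuration k m) {f g : Vec (Fin m) k → Fin k} →
             (∀ x → f x ≡ g x) → Valid P f → Valid P g
valid-cong P f≗g = All.map (λ {x} → All.map (λ {y} v gx≡gy πx≡πy →
  v (trans (f≗g x) (trans gx≡gy (sym (f≗g y))))
    (subst (λ i → π i x ≡ π i y) (sym (f≗g x)) πx≡πy)))

-- Owner functions are searched through their finitely many tables of values; `valid-cong` lets a
-- table stand for the function.
coverable? : (P : Configuration (suc k) m) → Dec (Coverable P)
coverable? P = map′
  (λ (_ , valid) → valid⇒coverable P valid)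
  (λ cover → let owner , valid = coverable⇒valid cover in
     tabulate (owner ∘ decode) , valid-cong P (λ x → sym (trans
       (lookup∘tabulate (owner ∘ decode) (encode x)) (cong owner (decode-encode x)))) valid)
  (anyVec? (λ table → valid? P (λ x → lookup table (encode x))))

unique? : (x : Vec (Fin m) k) → Dec (Vec.Unique x)
unique? = VecAllPairs.allPairs? (λ a b → ¬? (a ≟ b))

-- Any set of codes is allowed, since improper tuples are filtered out; configurations thus become
-- searchable by `anySubset?`.
config : Subset (m ^ k) → Configuration k m
config T = record
  { tuples = filter unique? (map decode (elements T))
  ; proper = All.all-filter unique? (map decode (elements T))
  ; unique = List.filter⁺ unique? (List.map⁺ decode-injective (elements-unique T))
  }

-- Upper bound: winning forces small configurations to be coverable.

module _ {k m n q : ℕ} (P : Configuration (suc k) m) (small : total P < suc q)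
         (s : Strategy (Book (suc k) n) (suc q)) where
  private
    ∣S∣≤q : length (elements (supp P)) ≤ suc q
    ∣S∣≤q = begin
      length (elements (supp P))  ≡⟨ length-elements (supp P) ⟩
      ∣ supp P ∣                  ≤⟨ ℕ.m≤n+m _ (size P) ⟩
      size P + ∣ supp P ∣         <⟨ small ⟩
      suc q                       ∎
      where open ℕ.≤-Reasoning

    -- `m` may exceed the `suc q` colors of the game, but only the support has to fit: it is moved
    -- to an initial segment by position. Outside it the value is a default.
    recolor : Fin m → Fin (suc q)
    recolor a with a ∈ₛ? supp P
    ... | yes a∈S = inject≤ (index (∈-elements⁺ a∈S)) ∣S∣≤q
    ... | no  _   = zero

    recolor-injective : ∀ {a b} → a ∈ₛ supp P → b ∈ₛ supp P → recolor a ≡ recolor b → a ≡ b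
    recolor-injective {a} {b} a∈S b∈S eq with a ∈ₛ? supp P | b ∈ₛ? supp P
    ... | yes a∈ | yes b∈ =
      index-injective (∈-elements⁺ a∈) (∈-elements⁺ b∈) (inject≤-injective _ _ _ _ eq)
    ... | no a∉  | _      = contradiction a∈S a∉
    ... | _      | no b∉  = contradiction b∈S b∉

    recolored : List (Fin (suc q))
    recolored = tabulateₗ (λ j → inject≤ j ∣S∣≤q)

    recolor∈recolored : ∀ {a} → a ∈ₛ supp P → recolor a ∈ recolored
    recolor∈recolored {a} a∈S with a ∈ₛ? supp P
    ... | yes a∈ = ∈-tabulate⁺ (index (∈-elements⁺ a∈))
    ... | no  a∉ = contradiction a∈S a∉

    guess : ∀ v → View (Book (suc k) n) (suc q) v → Fin (suc q)
    guess v = Guess.guess (s v)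

    -- A page sees no other page, so its guesses are known before any page is colored, and page
    -- colors can be chosen to evade them. The value on pages is a filler.
    pageView : Vec (Fin m) (suc k) → ∀ w → View (Book (suc k) n) (suc q) (inj₂ w)
    pageView x w (inj₁ i) _ = recolor (lookup x i)
    pageView x w (inj₂ _) _ = zero

    pageGuess : Fin n → Vec (Fin m) (suc k) → Fin (suc q)
    pageGuess w x = guess (inj₂ w) (pageView x w)

    -- The first list protects properness, the second makes page `w` wrong on all of `P`.
    avoided : Fin n → List (Fin (suc q))
    avoided w = recolored ++ map (pageGuess w) (tuples P)

    length-avoided : ∀ w → length (avoided w) < suc q
    length-avoided w = begin-strict
      length (avoided w)                          ≡⟨ length-++ recolored ⟩
      length recolored + length (map (pageGuess w) (tuples P))
        ≡⟨ cong₂ _+_ (length-tabulate _) (length-map (pageGuess w) (tuples P)) ⟩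
      length (elements (supp P)) + size P         ≡⟨ cong (_+ size P) (length-elements (supp P)) ⟩
      ∣ supp P ∣ + size P                         ≡⟨ ℕ.+-comm ∣ supp P ∣ (size P) ⟩
      size P + ∣ supp P ∣                         <⟨ small ⟩
      suc q                                       ∎
      where open ℕ.≤-Reasoning

    pageColor : Fin n → Fin (suc q)
    pageColor w = proj₁ (missing (avoided w) (length-avoided w))

    pageColor∉avoided : ∀ w → pageColor w ∉ avoided w
    pageColor∉avoided w = proj₂ (missing (avoided w) (length-avoided w))

    coloring : Vec (Fin m) (suc k) → Coloring (Book (suc k) n) (suc q)
    coloring x (inj₁ i) = recolor (lookup x i)
    coloring x (inj₂ w) = pageColor w

    pageColor≢recolor : ∀ {x} → x ∈ tuples P → ∀ i w → pageColor w ≢ recolor (lookup x i)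
    pageColor≢recolor {x} x∈P i w eq = pageColor∉avoided w
      (subst (_∈ avoided w) (sym eq) (∈-++⁺ˡ (recolor∈recolored (∈-supp⁺ P x∈P i))))

    coloring-proper : ∀ {x} → x ∈ tuples P → Proper (Book (suc k) n) (suc q) (coloring x)
    coloring-proper {x} x∈P (inj₁ i) (inj₁ j) i≢j eq = i≢j
      (Vec.lookup-injective (All.lookup (Configuration.proper P) x∈P) i j
        (recolor-injective (∈-supp⁺ P x∈P i) (∈-supp⁺ P x∈P j) eq))
    coloring-proper x∈P (inj₁ i) (inj₂ w) _ eq = pageColor≢recolor x∈P i w (sym eq)
    coloring-proper x∈P (inj₂ w) (inj₁ i) _ eq = pageColor≢recolor x∈P i w eq

    Correct : Vec (Fin m) (suc k) → Fin (suc k) → Set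
    Correct x i = guess (inj₁ i) (λ u _ → coloring x u) ≡ coloring x (inj₁ i)

    correct? : ∀ x → Decidable (Correct x)
    correct? x i = guess (inj₁ i) (λ u _ → coloring x u) ≟ coloring x (inj₁ i)

    page-wrong : ∀ {x} → x ∈ tuples P → ∀ w → guess (inj₂ w) (λ u _ → coloring x u) ≢ pageColor w
    page-wrong {x} x∈P w eq = pageColor∉avoided w (∈-++⁺ʳ recolored
      (subst (_∈ map (pageGuess w) (tuples P)) (trans (Guess.cong (s (inj₂ w)) sameView) eq)
        (∈-map⁺ (pageGuess w) x∈P)))
      where
      sameView : ∀ u .(a : FiniteSimpleGraph.Adj (Book (suc k) n) (inj₂ w) u) →
                 pageView x w u a ≡ coloring x u
      sameView (inj₁ _) _ = refl
      sameView (inj₂ _) ()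

    -- The page colors do not vary with the tuple, so only the coordinates other than `i` reach
    -- spine `i`.
    spine-sees : ∀ {x y i} → π i x ≡ π i y →
                 guess (inj₁ i) (λ u _ → coloring x u) ≡ guess (inj₁ i) (λ u _ → coloring y u)
    spine-sees {x} {y} {i} πx≡πy = Guess.cong (s (inj₁ i)) λ where
      (inj₁ j) i≢j → cong recolor (π⁻ {x = x} {y} πx≡πy (recompute (¬? (i ≟ j)) i≢j))
      (inj₂ w) _   → refl

    owner : Vec (Fin m) (suc k) → Fin (suc k)
    owner x = choose (correct? x)

  -- As all pages are wrong, each tuple of `P` has a correct spine as its owner. Two tuples with
  -- owner `i` and equal `π i` get the same guess, which is the recolored `i`-th entry of both.
  winning⇒valid : Winning (Book (suc k) n) (suc q) s → Valid P owner
  winning⇒valid win = All.tabulate λ {x} x∈P → All.tabulate λ {y} y∈P ox≡oy πx≡πy →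
    let i = owner x
        y-correct = subst (Correct y) (sym ox≡oy) (owner-correct y∈P)
        xᵢ≡yᵢ = recolor-injective (∈-supp⁺ P x∈P i) (∈-supp⁺ P y∈P i)
          (trans (sym (owner-correct x∈P)) (trans (spine-sees {x} {y} πx≡πy) y-correct))
    in lookup-ext λ j → agree {x} {y} i πx≡πy xᵢ≡yᵢ j
    where
    someCorrect : ∀ {x} → x ∈ tuples P → ∃ (Correct x)
    someCorrect {x} x∈P with win (coloring x) (coloring-proper x∈P)
    ... | inj₁ i , eq = i , eq
    ... | inj₂ w , eq = contradiction eq (page-wrong x∈P w)

    owner-correct : ∀ {x} → x ∈ tuples P → Correct x (owner x)
    owner-correct {x} x∈P = choose-correct (correct? x) (someCorrect x∈P)

    agree : ∀ {x y} i → π i x ≡ π i y → lookup x i ≡ lookup y i → ∀ j → lookup x j ≡ lookup y j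
    agree {x} {y} i πx≡πy xᵢ≡yᵢ j with i ≟ j
    ... | yes refl = xᵢ≡yᵢ
    ... | no  i≢j  = π⁻ {x = x} {y} πx≡πy i≢j

-- Contrapositively, a non-coverable configuration caps the number of colors by its total. As `m` is
-- arbitrary, the game also transfers coverability between color sets.
winning⇒coverable : (P : Configuration (suc k) m) → total P < q →
                    HasWinningStrategy (Book (suc k) n) q → Coverable P
winning⇒coverable {q = suc _} P small (s , win) = valid⇒coverable P (winning⇒valid P small s win)

-- Strategies given on colorings, and deciding whether one wins.

-- Since functions cannot be compared, strategies are given by functions of
-- colorings, and colorings that agree where v sees them are made equal by
-- tabulation.
module FromColorings (G : FiniteSimpleGraph) (q : ℕ) where
  open FiniteSimpleGraph G using (Vertex; order; enum; Adj; adj?)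
  open Inverse enum using (to; from; strictlyInverseˡ)

  private
    extend : ∀ {v} → View G (suc q) v → Vertex → Fin (suc q)
    extend {v} f u with adj? v u
    ... | yes a = f u a
    ... | no  _ = zero

    extend-cong : ∀ {v} {f g : View G (suc q) v} → (∀ u .(a : Adj v u) → f u a ≡ g u a) →
                  ∀ u → extend f u ≡ extend g u
    extend-cong {v} f≗g u with adj? v u
    ... | yes a = f≗g u a
    ... | no  _ = refl

    extend-adj : ∀ {v} (c : Coloring G (suc q)) u → Adj v u → extend {v} (λ u _ → c u) u ≡ c u
    extend-adj {v} c u a with adj? v u
    ... | yes _ = refl
    ... | no ¬a = contradiction a ¬a

    tabulated : ∀ {v} → View G (suc q) v → Vec (Fin (suc q)) order
    tabulated f = tabulate (λ j → extend f (to j))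

  -- The coloring that `strategy t v` hands to `t v` when the colors are `c`: vertices not adjacent
  -- to `v` are reset to `zero`.
  blank : Vertex → Coloring G (suc q) → Coloring G (suc q)
  blank v c u = lookup (tabulated {v} (λ u _ → c u)) (from u)

  blank-adj : ∀ {v} c u → Adj v u → blank v c u ≡ c u
  blank-adj {v} c u a = begin
    blank v c u              ≡⟨ lookup∘tabulate (λ j → extend {v} (λ u _ → c u) (to j)) (from u) ⟩
    extend {v} _ (to (from u)) ≡⟨ cong (extend {v} _) (strictlyInverseˡ u) ⟩
    extend {v} _ u           ≡⟨ extend-adj c u a ⟩
    c u                      ∎
    where open ≡-Reasoning

  strategy : (Vertex → Coloring G (suc q) → Fin (suc q)) → Strategy G (suc q)
  strategy t v = record
    { guess = λ f → t v (λ u → lookup (tabulated f) (from u))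
    ; cong  = λ f≗g → cong (λ x → t v (λ u → lookup x (from u)))
                (tabulate-cong (λ j → extend-cong f≗g (to j)))
    }

module _ (G : FiniteSimpleGraph) where
  open FiniteSimpleGraph G using (Vertex; order; enum; Adj; adj?)
  open Inverse enum using (to; from; strictlyInverseˡ; strictlyInverseʳ)

  winning? : ∀ {q} → Decidable (Winning G q)
  winning? {q} s = map′ sound (λ win x → win (lookup x ∘ from)) (allVec? λ x →
    proper? (lookup x ∘ from) →-dec map′
      (λ (j , p) → to j , p)
      (λ (v , p) → from v , subst (Right (lookup x ∘ from)) (sym (strictlyInverseˡ v)) p)
      (any? (λ j → guess (to j) (lookup x ∘ from) ≟ lookup x (from (to j)))))
    where
    guess : Vertex → Coloring G q → Fin q
    guess v c = Guess.guess (s v) (λ u _ → c u)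

    Right : Coloring G q → Vertex → Set
    Right c v = guess v c ≡ c v

    proper? : Decidable (Proper G q)
    proper? c = map′
      (λ p u v → pulled-back (p (from u) (from v)))
      (λ p i j → p (to i) (to j))
      (all? λ i → all? λ j → adj? (to i) (to j) →-dec ¬? (c (to i) ≟ c (to j)))
      where
      pulled-back : ∀ {u v} →
                    (Adj (to (from u)) (to (from v)) → c (to (from u)) ≢ c (to (from v))) →
                    Adj u v → c u ≢ c v
      pulled-back {u} {v} p rewrite strictlyInverseˡ u | strictlyInverseˡ v = p

    sound : (∀ x → Proper G q (lookup x ∘ from) → ∃ (Right (lookup x ∘ from))) → Winning G q s
    sound p c proper = v , trans (sym (Guess.cong (s v) (λ u _ → same u))) (trans right (same v))
      where
      x = tabulate (c ∘ to)
      same : ∀ u → lookup x (from u) ≡ c u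
      same u = trans (lookup∘tabulate (c ∘ to) (from u)) (cong c (strictlyInverseˡ u))
      winner = p x λ u v a eq → proper u v a (trans (sym (same u)) (trans eq (same v)))
      v = proj₁ winner
      right = proj₂ winner

  module _ (q : ℕ) where
    open FromColorings G q

    private
      -- For each vertex, the code of a function from all colorings of the graph to colors.
      Table : Set
      Table = Vec (Fin (suc q ^ (suc q ^ order))) order

      fromTable : Table → Strategy G (suc q)
      fromTable T = strategy λ v c → finToFun (lookup T (from v)) (encode (tabulate (c ∘ to)))

      toTable : Strategy G (suc q) → Table
      toTable s = tabulate λ j → funToFin λ a →
        Guess.guess (s (to j)) (λ u _ → lookup (decode a) (from u))

      -- The table is consulted at the blanked coloring, which agrees with `c` on the neighbors of
      -- `v`.
      same-guess : ∀ s c v → Guess.guess (fromTable (toTable s) v) (λ u _ → c u) ≡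
                             Guess.guess (s v) (λ u _ → c u)
      same-guess s c v = subst P (strictlyInverseˡ v) (enumerated (from v))
        where
        P : Vertex → Set
        P v = Guess.guess (fromTable (toTable s) v) (λ u _ → c u) ≡
              Guess.guess (s v) (λ u _ → c u)

        enumerated : ∀ j → P (to j)
        enumerated j = begin
          finToFun (lookup (toTable s) (from (to j))) (encode x)
            ≡⟨ cong (λ i → finToFun (lookup (toTable s) i) (encode x)) (strictlyInverseʳ j) ⟩
          finToFun (lookup (toTable s) j) (encode x)
            ≡⟨ cong (λ t → finToFun t (encode x)) (lookup∘tabulate _ j) ⟩
          finToFun (funToFin (λ a → Guess.guess (s (to j)) (λ u _ → lookup (decode a) (from u))))
                   (encode x)
            ≡⟨ finToFun-funToFin _ (encode x) ⟩
          Guess.guess (s (to j)) (λ u _ → lookup (decode (encode x)) (from u))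
            ≡⟨ cong (λ y → Guess.guess (s (to j)) (λ u _ → lookup y (from u))) (decode-encode x) ⟩
          Guess.guess (s (to j)) (λ u _ → lookup x (from u))
            ≡⟨ Guess.cong (s (to j)) (λ u a → seen u (recompute (adj? (to j) u) a)) ⟩
          Guess.guess (s (to j)) (λ u _ → c u) ∎
          where
          open ≡-Reasoning
          b = blank (to j) c
          x = tabulate (b ∘ to)
          seen : ∀ u → Adj (to j) u → lookup x (from u) ≡ c u
          seen u a = trans (lookup∘tabulate (b ∘ to) (from u))
            (trans (cong b (strictlyInverseˡ u)) (blank-adj c u a))

    -- Lets the hat-guessing number be found constructively for each number of pages.
    hasWinningStrategy? : Dec (HasWinningStrategy G (suc q))
    hasWinningStrategy? = map′
      (λ (T , win) → fromTable T , win)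
      (λ (s , win) → toTable s , λ c proper →
        let v , right = win c proper in v , trans (same-guess s c v) right)
      (anyVec? (winning? ∘ fromTable))

-- Lower bound: a winning strategy on enough pages.

-- Reads `y` only away from coordinate `i`, where spine `i` can see. Saturation makes the matching
-- tuple of `A` unique, so its `i`-th entry can be guessed.
recall : Fin k → List (Vec (Fin (suc q)) k) → Vec (Fin (suc q)) k → Fin (suc q)
recall i A y with Any.any? (λ x → π i x ≟ᵥ π i y) A
... | yes x∈ = lookup (Any.lookup x∈) i
... | no  _  = zero

recall-correct : {i : Fin k} {A : List (Vec (Fin (suc q)) k)} → Saturated i A →
                 ∀ {x y} → x ∈ A → π i x ≡ π i y → recall i A y ≡ lookup x i
recall-correct {i = i} {A} saturated {x} {y} x∈ πx≡πy
  with Any.any? (λ z → π i z ≟ᵥ π i y) A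
... | yes z∈ = cong (λ z → lookup z i)
  (saturated (∈-lookup (index z∈)) x∈ (trans (Any.lookup-result z∈) (sym πx≡πy)))
... | no  z∉ = contradiction (Any.map (λ { refl → πx≡πy }) x∈) z∉

module _ {k n p : ℕ}
         (coverable : (T : Subset (suc p ^ suc k)) →
                      total {suc k} {suc p} (config T) < suc p →
                      Coverable {suc k} {suc p} (config T))
         (enough : suc p ^ (suc p ^ suc k) ≤ n) where
  private
    q⁺ = suc p

    -- Page `w` carries the function coded by the number `w`; pages beyond the last code guess
    -- `zero`.
    guessTable : Fin n → Fin (q⁺ ^ suc k) → Fin q⁺
    guessTable w with toℕ w ℕ.<? q⁺ ^ (q⁺ ^ suc k)
    ... | yes w<N = finToFun (fromℕ< w<N)
    ... | no  _   = const zero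

    guessTable-onto : ∀ g → ∃[ w ] ∀ a → guessTable w a ≡ g a
    guessTable-onto g = w , table
      where
      w = inject≤ (funToFin g) enough
      w≡g : toℕ w ≡ toℕ (funToFin g)
      w≡g = toℕ-inject≤ (funToFin g) enough
      table : ∀ a → guessTable w a ≡ g a
      table a with toℕ w ℕ.<? q⁺ ^ (q⁺ ^ suc k)
      ... | yes w<N = trans (cong (λ b → finToFun b a) (toℕ-injective (trans (toℕ-fromℕ< w<N) w≡g)))
                            (finToFun-funToFin g a)
      ... | no  w≮N = contradiction (subst (_< _) (sym w≡g) (toℕ<n (funToFin g))) w≮N

    pageGuess : Fin n → Vec (Fin q⁺) (suc k) → Fin q⁺
    pageGuess w x = guessTable w (encode x)

    pageGuess-onto : ∀ g → ∃[ w ] ∀ x → pageGuess w x ≡ g x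
    pageGuess-onto g with w , eq ← guessTable-onto (g ∘ decode) =
      w , λ x → trans (eq (encode x)) (cong g (decode-encode x))

    Survives : Vec (Fin q⁺) n → Vec (Fin q⁺) (suc k) → Set
    Survives γ x = ∀ w → (∀ i → lookup x i ≢ lookup γ w) × pageGuess w x ≢ lookup γ w

    survives? : ∀ γ → Decidable (Survives γ)
    survives? γ x = all? λ w →
      all? (λ i → ¬? (lookup x i ≟ lookup γ w)) ×-dec ¬? (pageGuess w x ≟ lookup γ w)

    survivors : Vec (Fin q⁺) n → Subset (q⁺ ^ suc k)
    survivors γ = comprehension (survives? γ ∘ decode)

    surviving : Vec (Fin q⁺) n → Configuration (suc k) q⁺
    surviving γ = config (survivors γ)

    ∈-surviving⁺ : ∀ {γ x} → Vec.Unique x → Survives γ x → x ∈ tuples (surviving γ)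
    ∈-surviving⁺ {γ} {x} unique survives = ∈-filter⁺ unique?
      (subst (_∈ map decode (elements (survivors γ))) (decode-encode x)
        (∈-map⁺ decode (∈-elements⁺ (∈-comprehension⁺ (survives? γ ∘ decode)
          (subst (Survives γ) (sym (decode-encode x)) survives)))))
      unique

    ∈-surviving⁻ : ∀ {γ x} → x ∈ tuples (surviving γ) → Survives γ x
    ∈-surviving⁻ {γ} x∈R
      with _ , a∈ , refl ← ∈-map⁻ decode
             (proj₁ (∈-filter⁻ unique? {xs = map decode (elements (survivors γ))} x∈R))
      = ∈-comprehension⁻ (survives? γ ∘ decode) (∈-elements⁻ a∈)

    -- Otherwise there are at most `size R` colors outside the support, and some page exhausts them
    -- with its guesses on `R`. Its own color lies either in the support, against compatibility, or
    -- among those guesses, making it right on a tuple of `R`.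
    surviving-small : ∀ γ → total (surviving γ) < q⁺
    surviving-small γ = ℕ.≰⇒> impossible
      where
      R = surviving γ
      unused = elements (∁ (supp R))

      unused≤size : q⁺ ≤ total R → length unused ≤ size R
      unused≤size q≤ = begin
        length unused                         ≡⟨ length-elements (∁ (supp R)) ⟩
        ∣ ∁ (supp R) ∣                        ≡⟨ ∣∁p∣≡n∸∣p∣ (supp R) ⟩
        q⁺ ∸ ∣ supp R ∣                        ≤⟨ ℕ.∸-monoˡ-≤ ∣ supp R ∣ q≤ ⟩
        size R + ∣ supp R ∣ ∸ ∣ supp R ∣      ≡⟨ ℕ.m+n∸n≡m (size R) ∣ supp R ∣ ⟩
        size R                                ∎
        where open ℕ.≤-Reasoning

      impossible : ¬ q⁺ ≤ total R
      impossible q≤ = refute (lookup γ w ∈ₛ? supp R)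
        where
        exhaust = pageGuess-onto (assign _≟ᵥ_ zero (tuples R) unused)
        w = proj₁ exhaust

        refute : ¬ Dec (lookup γ w ∈ₛ supp R)
        refute (yes γw∈) with x , x∈R , i , eq ← ∈-supp⁻ R γw∈ = proj₁ (∈-surviving⁻ {γ} x∈R w) i eq
        refute (no  γw∉)
          with x , x∈R , eq ← assign-onto _≟ᵥ_ zero (Configuration.unique R) (unused≤size q≤)
                                (∈-elements⁺ (x∉p⇒x∈∁p γw∉))
          = proj₂ (∈-surviving⁻ {γ} x∈R w) (trans (proj₂ exhaust x) eq)

    cover : ∀ γ → Coverable (surviving γ)
    cover γ = coverable (survivors γ) (surviving-small γ)

    ownedBy : Fin (suc k) → Vec (Fin q⁺) n → List (Vec (Fin q⁺) (suc k))
    ownedBy i γ = Coverable.part (cover γ) i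

    open FromColorings (Book (suc k) n) p

    guess : Fin (suc k) ⊎ Fin n → Coloring (Book (suc k) n) q⁺ → Fin q⁺
    guess (inj₁ i) c = recall i (ownedBy i (tabulate (c ∘ inj₂))) (tabulate (c ∘ inj₁))
    guess (inj₂ w) c = pageGuess w (tabulate (c ∘ inj₁))

    -- If every page errs, the spine tuple survives and lies in some part `i`. Spine `i` sees all
    -- page colors, so it knows that part and can recall its color.
    strategy-wins : Winning (Book (suc k) n) q⁺ (strategy guess)
    strategy-wins c proper with any? (λ w → pageGuess w (tabulate (c ∘ inj₁)) ≟ c (inj₂ w))
    ... | yes (w , eq) = inj₂ w ,
      trans (cong (pageGuess w) (tabulate-cong (λ i → blank-adj {inj₂ w} c (inj₁ i) tt))) eq
    ... | no  allWrong = inj₁ i , (begin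
        recall i (ownedBy i (tabulate (b ∘ inj₂))) y
          ≡⟨ cong (λ γ → recall i (ownedBy i γ) y)
               (tabulate-cong (λ w → blank-adj {inj₁ i} c (inj₂ w) tt)) ⟩
        recall i (ownedBy i γ) y
          ≡⟨ recall-correct (Coverable.saturated (cover γ) i) x∈ πx≡πy ⟩
        lookup x i
          ≡⟨ lookup∘tabulate (c ∘ inj₁) i ⟩
        c (inj₁ i) ∎)
      where
      open ≡-Reasoning
      γ = tabulate (c ∘ inj₂)
      x = tabulate (c ∘ inj₁)

      spines-distinct : ∀ {i j} → c (inj₁ i) ≡ c (inj₁ j) → i ≡ j
      spines-distinct {i} {j} eq =
        decidable-stable (i ≟ j) (λ i≢j → proper (inj₁ i) (inj₁ j) i≢j eq)

      survives : Survives γ x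
      survives w rewrite lookup∘tabulate (c ∘ inj₂) w =
        (λ i eq → proper (inj₁ i) (inj₂ w) tt (trans (sym (lookup∘tabulate (c ∘ inj₁) i)) eq)) ,
        (λ eq → allWrong (w , eq))

      owned = Equivalence.to (Coverable.union (cover γ) x)
                (∈-surviving⁺ {γ} (Vec.tabulate⁺ spines-distinct) survives)
      i = proj₁ owned
      x∈ = proj₂ owned

      -- Spine `i` works from `y`, the spine tuple with its unseen `i`-th entry replaced by `zero`.
      b = blank (inj₁ i) c
      y = tabulate (b ∘ inj₁)

      πx≡πy : π i x ≡ π i y
      πx≡πy = π⁺ {x = x} {y} λ j i≢j → trans (lookup∘tabulate (c ∘ inj₁) j)
        (trans (sym (blank-adj {inj₁ i} c (inj₁ j) i≢j)) (sym (lookup∘tabulate (b ∘ inj₁) j)))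

  coverable⇒winning : HasWinningStrategy (Book (suc k) n) q⁺
  coverable⇒winning = strategy guess , strategy-wins

-- Existence of a non-coverable configuration.

-- Tuples taking their i-th color from the i-th of k disjoint classes of k + 1
-- colors: an i-saturated set has at most (k + 1)^(k - 1) of the (k + 1)^k tuples.
module _ (k′ : ℕ) where
  private
    k⁺ = suc k′

    tuple : Fin (suc k⁺ ^ k⁺) → Vec (Fin (k⁺ * suc k⁺)) k⁺
    tuple a = tabulate (λ i → combine i (finToFun {suc k⁺} {k⁺} a i))

    lookup-tuple : ∀ a i → lookup (tuple a) i ≡ combine i (finToFun {suc k⁺} {k⁺} a i)
    lookup-tuple a = lookup∘tabulate (λ i → combine i (finToFun {suc k⁺} {k⁺} a i))

    tuple-proper : ∀ a → Vec.Unique (tuple a)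
    tuple-proper a = Vec.tabulate⁺ λ {i} {j} eq →
      proj₁ (combine-injective i (finToFun {suc k⁺} {k⁺} a i) j (finToFun {suc k⁺} {k⁺} a j) eq)

    tuple-injective : ∀ {a b} → tuple a ≡ tuple b → a ≡ b
    tuple-injective {a} {b} eq = finToFun-injective {suc k⁺} {k⁺} λ i →
      proj₂ (combine-injective i (finToFun {suc k⁺} {k⁺} a i) i (finToFun {suc k⁺} {k⁺} b i)
        (trans (sym (lookup-tuple a i)) (trans (cong (λ x → lookup x i) eq) (lookup-tuple b i))))

  productConfiguration : Configuration k⁺ (k⁺ * suc k⁺)
  productConfiguration = record
    { tuples = map tuple (allFin (suc k⁺ ^ k⁺))
    ; proper = All.map⁺ (All.universal tuple-proper (allFin _))
    ; unique = List.map⁺ tuple-injective (List.allFin⁺ _)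
    }

  private
    module _ (cover : Coverable productConfiguration) where
      open Coverable cover

      owned : ∀ a → ∃[ i ] tuple a ∈ part i
      owned a = Equivalence.to (union (tuple a)) (∈-map⁺ tuple (∈-allFin a))

      rest : Fin k⁺ → Fin (suc k⁺ ^ k⁺) → Fin (suc k⁺ ^ k′)
      rest i a = funToFin (λ j → finToFun {suc k⁺} {k⁺} a (punchIn i j))

      -- Within part `i` the coordinates other than `i` determine the tuple, so a cover makes this
      -- map injective.
      label : Fin (suc k⁺ ^ k⁺) → Fin (k⁺ * suc k⁺ ^ k′)
      label a = combine (proj₁ (owned a)) (rest (proj₁ (owned a)) a)

      same-rest : ∀ {i a b} → rest i a ≡ rest i b → π i (tuple a) ≡ π i (tuple b)
      same-rest {i} {a} {b} eq = π⁺ {x = tuple a} {tuple b} λ j i≢j → begin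
        lookup (tuple a) j
          ≡⟨ lookup-tuple a j ⟩
        combine j (finToFun a j)
          ≡⟨ cong (combine j ∘ finToFun {suc k⁺} {k⁺} a) (punchIn-punchOut {i = i} i≢j) ⟨
        combine j (finToFun a (punchIn i (punchOut i≢j)))
          ≡⟨ cong (combine j) (coordinate (punchOut {i = i} i≢j)) ⟩
        combine j (finToFun b (punchIn i (punchOut i≢j)))
          ≡⟨ cong (combine j ∘ finToFun {suc k⁺} {k⁺} b) (punchIn-punchOut {i = i} i≢j) ⟩
        combine j (finToFun b j)
          ≡⟨ lookup-tuple b j ⟨
        lookup (tuple b) j ∎
        where
        open ≡-Reasoning
        coordinate : ∀ j → finToFun {suc k⁺} {k⁺} a (punchIn i j) ≡ finToFun b (punchIn i j)
        coordinate j = trans (sym (finToFun-funToFin _ j))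
          (trans (cong (λ c → finToFun {suc k⁺} {k′} c j) eq) (finToFun-funToFin _ j))

      separated : ∀ {a b i j} → tuple a ∈ part i → tuple b ∈ part j →
                  combine i (rest i a) ≡ combine j (rest j b) → a ≡ b
      separated {a} {b} {i} {j} a∈ b∈ eq with combine-injective i (rest i a) j (rest j b) eq
      ... | refl , rest≡ = tuple-injective (saturated i a∈ b∈ (same-rest {i} {a} {b} rest≡))

      label-injective : ∀ {a b} → label a ≡ label b → a ≡ b
      label-injective {a} {b} = separated (proj₂ (owned a)) (proj₂ (owned b))

  ¬coverable-product : ¬ Coverable productConfiguration
  ¬coverable-product cover = ℕ.<⇒≱
    -- For k = `k⁺`, the number (k + 1)^k exceeds k (k + 1)^(k - 1) by (k + 1)^(k - 1).
    (ℕ.m<n+m (k⁺ * suc k⁺ ^ k′) {suc k⁺ ^ k′} (ℕ.m^n>0 (suc k⁺) k′))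
    (injective⇒≤ (label-injective cover))

-- The extremal value and the theorem.

-- Confining the colors to `Fin q` makes the search finite; `winning⇒coverable` carries conclusions
-- over to arbitrary color sets.
SmallNonCoverable : ℕ → ℕ → Set
SmallNonCoverable k q = ∃[ T ] (¬ Coverable {k} {q} (config T) × total {k} {q} (config T) < q)

smallNonCoverable? : ∀ k → Decidable (SmallNonCoverable (suc k))
smallNonCoverable? k q = anySubset? λ T →
  ¬? (coverable? (config T)) ×-dec (total {suc k} {q} (config T) ℕ.<? q)

¬small⇒winning : ∀ {k q n} → ¬ SmallNonCoverable (suc k) (suc q) → suc q ^ (suc q ^ suc k) ≤ n →
                 HasWinningStrategy (Book (suc k) n) (suc q)
¬small⇒winning {k} {q} none = coverable⇒winning λ T small →
  decidable-stable (coverable? (config T)) (λ ¬cover → none (T , ¬cover , small))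

oneColorWins : HasWinningStrategy (Book (suc k) n) 1
oneColorWins = (λ v → record { guess = const zero ; cong = const refl }) ,
  (λ c _ → inj₁ zero , unique-color (c (inj₁ zero)))
  where
  unique-color : (a : Fin 1) → zero ≡ a
  unique-color zero = refl

-- Descends from `d + a` to the first failure of `P`, which is met at `a` at the latest.
threshold : {P : ℕ → Set} → Decidable P →
            ∀ d {a} → ¬ P a → P (d + a) → ∃[ b ] (¬ P (b + a) × P (suc b + a))
threshold P? zero    ¬Pa Pa = contradiction Pa ¬Pa
threshold {P} P? (suc d) {a} ¬Pa Psd with P? (d + a)
... | yes Pd = threshold P? d ¬Pa Pd
... | no ¬Pd = d , ¬Pd , Psd

-- Descends from the bound to the first member. Only positive numbers are tested: at bound 0 the
-- given member must itself be 0.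
greatest : {S : ℕ → Set} → (∀ q → Dec (S (suc q))) →
           ∀ b {a} → S a → IsUpperBound S b → ∃ (IsGreatest S)
greatest S? zero    Sa bound with z≤n ← bound _ Sa = 0 , Sa , bound
greatest {S} S? (suc b) Sa bound with S? b
... | yes Sb = suc b , Sb , bound
... | no ¬Sb = greatest S? b Sa λ q Sq → ℕ.≤-pred (ℕ.≤∧≢⇒< (bound q Sq) λ { refl → ¬Sb Sq })

theorem1p1 : ∀ (k : ℕ) → 2 ≤ k →
    ∃[ C ]
    ( IsC k C
    × (∀ n → 1 ≤ n → ∃[ h ] IsHGP (Book k n) h)
    × IsSupremum (λ h → ∃[ n ] (1 ≤ n × IsHGP (Book k n) h)) C
    × (∃[ N ] (∀ n → N ≤ n → IsHGP (Book k n) C)) )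
theorem1p1 (suc k) _ =
  -- `C` is attained at `suc N` pages, hence lies below every upper bound; the `suc` makes the
  -- number of pages positive.
  C , isC , hgp , (bound , λ b above → above C (suc N , s≤s z≤n , hgp≡C (suc N) (ℕ.n≤1+n N))) ,
  N , hgp≡C
  where
  none : ¬ SmallNonCoverable (suc k) 1
  none (T , ¬cover , small) = ¬cover (winning⇒coverable {n = 0} (config T) small oneColorWins)

  product = productConfiguration k
  s = total product

  some : SmallNonCoverable (suc k) (s + 1)
  some = subst (SmallNonCoverable (suc k)) (ℕ.+-comm 1 s)
    -- Otherwise `suc s` colors could be won, although the non-coverable `product` has total `s`.
    (decidable-stable (smallNonCoverable? k (suc s)) λ ¬small →
      ¬coverable-product k
        (winning⇒coverable product ℕ.≤-refl (¬small⇒winning ¬small ℕ.≤-refl)))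

  -- The offset 1 keeps the number of colors positive: the failure found is at `c + 1`, and one
  -- color more admits a small non-coverable configuration.
  found = threshold (smallNonCoverable? k) s none some
  c = proj₁ found
  C = suc c
  N = C ^ (C ^ suc k)

  noneAtC : ¬ SmallNonCoverable (suc k) C
  noneAtC = subst (¬_ ∘ SmallNonCoverable (suc k)) (ℕ.+-comm c 1) (proj₁ (proj₂ found))

  someAfterC : SmallNonCoverable (suc k) (suc C)
  someAfterC = subst (SmallNonCoverable (suc k)) (ℕ.+-comm (suc c) 1) (proj₂ (proj₂ found))

  minimal = config (proj₁ someAfterC)
  ¬coverable-minimal = proj₁ (proj₂ someAfterC)
  minimal-small = proj₂ (proj₂ someAfterC)

  win : ∀ n → N ≤ n → HasWinningStrategy (Book (suc k) n) C
  win n = ¬small⇒winning noneAtC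

  least : ∀ {m} (P : Configuration (suc k) m) → ¬ Coverable P → C ≤ total P
  -- Winning with `C` colors on `N` pages makes every configuration of total below `C` coverable,
  -- whatever its color set.
  least P ¬cover = ℕ.≮⇒≥ λ small → ¬cover (winning⇒coverable P small (win N ℕ.≤-refl))

  isC : IsC (suc k) C
  -- The total is below `suc C` by choice and at least `C` by `least`.
  isC = (suc C , minimal , ¬coverable-minimal ,
         ℕ.≤-antisym (least minimal ¬coverable-minimal) (ℕ.≤-pred minimal-small)) ,
        λ { _ (_ , P , ¬cover , refl) → least P ¬cover }

  winning≤C : ∀ n → IsUpperBound (HasWinningStrategy (Book (suc k) n)) C
  winning≤C n q w = ℕ.≮⇒≥ λ C<q →
    ¬coverable-minimal (winning⇒coverable minimal (ℕ.<-≤-trans minimal-small C<q) w)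

  hgp : ∀ n → 1 ≤ n → ∃[ h ] IsHGP (Book (suc k) n) h
  hgp n _ = greatest (hasWinningStrategy? (Book (suc k) n)) C oneColorWins (winning≤C n)

  hgp≡C : ∀ n → N ≤ n → IsHGP (Book (suc k) n) C
  hgp≡C n N≤n = win n N≤n , winning≤C n

  bound : IsUpperBound (λ h → ∃[ n ] (1 ≤ n × IsHGP (Book (suc k) n) h)) C
  bound h (n , _ , isHGP) = winning≤C n h (proj₁ isHGP)
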